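{- For every positive integer $N$, the map $\Phi_N$ restricts to a bijection from $\mathcal{ROP}_N$ (the $N$-party reduced odd partitions) onto $\mathcal{RL}_N$ (the reduced lecture hall partitions of width $N$).
   Context: A partition is a finite weakly decreasing sequence $\lambda=(\lambda_1\ge\lambda_2\ge\dots\ge\lambda_\ell>0)$ of positive integers (the empty partition $\emptyset$ is allowed); $\ell(\lambda)=\ell$ is its length, and $m_i(\lambda)$ the multiplicity of $i$ as a part. Partitions are identified with sequences obtained by appending zeros. Finitely supported integer sequences are added and subtracted entrywise ($+$, $-$). $\lambda\sqcup\mu$ is the partition whose multiset of parts is the union (multiplicities added) of those of $\lambda$ and $\mu$; $(a)^m$ is the partition with $m$ parts equal to $a$. Lecture hall partitions. For a positive integer $N$, $\mathcal{L}_N$ is the set of partitions $\mu$ with $\ell(\mu)\le N$ and $$\frac{\mu_1}{N}\ge\frac{\mu_2}{N-1}\ge\dots\ge\frac{\mu_{\ell(\mu)}}{N-\ell(\mu)+1}$$ ($\emptyset\in\mathcal{L}_N$). A partition $\mu\in\mathcal{L}_N$ is reduced if for every $i$ with $1\le i\le \ell(\mu)$ the sequence obtained from $\mu$ by replacing $\mu_i$ with $\mu_i-(N-i+1)$ (leaving other entries unchanged) is not in $\mathcal{L}_N$; trailing zeros are deleted, and a sequence that is not a partition is not in $\mathcal{L}_N$. $\mathcal{RL}_N$ is the set of reduced elements of $\mathcal{L}_N$. Odd partitions. $\mathcal{OP}_N$ is the set of partitions all of whose parts are odd and at most $2N$, and $\mathcal{ROP}_N=\{\lambda\in\mathcal{OP}_N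 : m_{2k-1}(\lambda)\le N-k \text{ for all } 1\le k\le N\}$. Trapezoids. For $n\ge k\ge1$, $[\Diamond]_{n,k}=(n,n-1,\dots,n-2k+2)$ if $k\le n/2$ and $[\Diamond]_{n,k}=(n,n-1,\dots,2k-n-1)$ if $k>n/2$ (a trailing $0$ is dropped); $[\Diamond]_{k-1,k}=\emptyset$. For $i,k\ge1$ put $A_{i,k}=[\Diamond]_{k+i-1,k}-[\Diamond]_{k+i-2,k}$, an integer sequence. The map $\Phi_N$ and the counter $I$. For $\lambda\in\mathcal{OP}_N$ an integer sequence $\Phi_N(\lambda)$ and a counter $I(\lambda)=[I_1(\lambda),\dots,I_N(\lambda)]$ of nonnegative integers are defined recursively by inserting the parts of $\lambda$ in weakly decreasing order. Start: $\Phi_N(\emptyset)=\emptyset$, $I(\emptyset)=[0,\dots,0]$. Step: if $2k-1$ ($1\le k\le N$) is at most every part of $\lambda$, let $i(\lambda)=\min\{j: I_j(\lambda)=0\}$; then $\Phi_N(\lambda\sqcup(2k-1))=\Phi_N(\lambda)+A_{i(\lambda),k}$, and $I(\lambda\sqcup(2k-1))$ is obtained from $I(\lambda)$ by decreasing each $I_j(\lambda)$ with $j<i(\lambda)$ by $1$, setting the $i(\lambda)$-th entry equal to $N-k-i(\lambda)+1$, and leaving the entries with $j>i(\lambda)$ unchanged. -}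

module Defs where

open import Data.Bool.Base using (if_then_else_)
open import Data.Integer.Base as ℤ using (ℤ; +_)
open import Data.List.Base using (List; []; _∷_; length; filter; applyUpTo; foldl)
open import Data.List.Relation.Unary.All using (All)
open import Data.List.Relation.Unary.Linked using (Linked)
open import Data.Nat.Base
open import Data.Nat.Divisibility using (_∤_)
open import Data.Nat.Properties using (_≟_)
open import Data.Product.Base using (_×_; _,_; proj₁; ∃-syntax)
open import Data.Rational.Unnormalised.Base as ℚᵘ using (ℚᵘ)
open import Data.Vec.Base using (Vec; []; _∷_; replicate)
open import Relation.Binary.PropositionalEquality using (_≗_)
open import Relation.Nullary using (¬_)

-- Sequences are indexed from 0: position j holds the entry usually written
-- with index j + 1.  Two sequences are the same when they agree pointwise (_≗_).
Seq : Set
Seq = ℕ → ℤ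

-- A list followed by zeros.
⟦_⟧ : List ℕ → Seq
⟦ []     ⟧ j       = + 0
⟦ x ∷ xs ⟧ zero    = + x
⟦ x ∷ xs ⟧ (suc j) = ⟦ xs ⟧ j

_⊕_ _⊖_ : Seq → Seq → Seq
(s ⊕ t) j = s j ℤ.+ t j
(s ⊖ t) j = s j ℤ.- t j

IsPartition : List ℕ → Set
IsPartition μ = Linked _≥_ μ × All (1 ≤_) μ

multiplicity : ℕ → List ℕ → ℕ
multiplicity i μ = length (filter (i ≟_) μ)

-- A set of partitions, seen as a set of sequences by appending zeros.
_as-sequence : (List ℕ → Set) → (Seq → Set)
(P as-sequence) s = ∃[ μ ] (P μ × s ≗ ⟦ μ ⟧)

------------------------------------------------------------------------
-- Lecture hall partitions

-- For i = j + 1 ≤ N this is N - i + 1.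
width : ℕ → ℕ → ℕ
width N j = suc (N ∸ suc j)

ratio : ℕ → List ℕ → ℕ → ℚᵘ
ratio N μ j = ⟦ μ ⟧ j ℚᵘ./ width N j

LectureHall : ℕ → List ℕ → Set
LectureHall N μ =
    IsPartition μ
  × length μ ≤ N
  × (∀ j → suc j < length μ → ratio N μ j ℚᵘ.≥ ratio N μ (suc j))

lowerAt : ℕ → ℕ → Seq → Seq
lowerAt i d s j = if i ≡ᵇ j then s j ℤ.- + d else s j

-- The lowered sequence is tested as a sequence, so trailing zeros are
-- ignored, and it fails to be lecture hall when it is not a partition.
ReducedLectureHall : ℕ → List ℕ → Set
ReducedLectureHall N μ =
    LectureHall N μ
  × (∀ j → j < length μ →
       ¬ (LectureHall N as-sequence) (lowerAt j (width N j) ⟦ μ ⟧))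

------------------------------------------------------------------------
-- Odd partitions

OddPartition : ℕ → List ℕ → Set
OddPartition N μ = IsPartition μ × All (λ p → 2 ∤ p × p ≤ 2 * N) μ

ReducedOddPartition : ℕ → List ℕ → Set
ReducedOddPartition N μ =
    OddPartition N μ
  × (∀ k → 1 ≤ k → k ≤ N → multiplicity (2 * k ∸ 1) μ ≤ N ∸ k)

------------------------------------------------------------------------
-- Trapezoids

-- descend a b = a , a - 1 , … , b   (empty if a < b)
descend : ℕ → ℕ → List ℕ
descend a b = applyUpTo (a ∸_) (suc a ∸ b)

-- For n = k - 1 the second range is empty, as the convention for
-- trapezoid (k - 1) k requires.  The second range may end in 0 (when
-- n = 2k - 1), which ⟦_⟧ ignores.  All subtractions are exact for
-- k ≥ 1 and n ≥ k - 1.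
trapezoid : ℕ → ℕ → List ℕ
trapezoid n k =
  if 2 * k ≤ᵇ n then descend n ((n + 2) ∸ 2 * k)
                else descend n (2 * k ∸ (n + 1))

-- For i , k ≥ 1.
A : ℕ → ℕ → Seq
A i k = ⟦ trapezoid (k + i ∸ 1) k ⟧ ⊖ ⟦ trapezoid (k + i ∸ 2) k ⟧

------------------------------------------------------------------------
-- The insertion map

-- The least i ≥ 1 with I_i = 0.  While parts 2k - 1 ≤ 2N - 1 are inserted in
-- weakly decreasing order, I_j ≤ N - k - j + 1 for j ≤ N - k + 1, so
-- I_(N-k+1) = 0: a zero always exists, at some i ≤ N - k + 1, and the
-- clause for [] is never reached.
firstZero : ∀ {n} → Vec ℕ n → ℕ
firstZero []          = 1
firstZero (zero  ∷ I) = 1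
firstZero (suc _ ∷ I) = suc (firstZero I)

-- Decreases the entries before the first zero by 1 and replaces that zero by v.
updateCounter : ∀ {n} → ℕ → Vec ℕ n → Vec ℕ n
updateCounter v []          = []
updateCounter v (zero  ∷ I) = v ∷ I
updateCounter v (suc c ∷ I) = c ∷ updateCounter v I

insert : ∀ N → Seq × Vec ℕ N → ℕ → Seq × Vec ℕ N
insert N (s , I) p = s ⊕ A i k , updateCounter ((N + 1) ∸ (k + i)) I
  where
  -- k = (p + 1) / 2, so that p = 2k - 1 for odd p.
  k = ⌈ p /2⌉
  i = firstZero I

-- The parts of a partition are listed in weakly decreasing order, so
-- inserting from the left inserts each part after all those at least as large.
Φ : ℕ → List ℕ → Seq
Φ N μ = proj₁ (foldl (insert N) ((λ _ → + 0) , replicate N 0) μ)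

{-# OPTIONS --safe #-}

-- While parts 2k - 1 are inserted, the counter is the Lehmer code of a permutation of the columns
-- 1, …, N - k + 1, and an insertion uses the first column and moves it to the end.  Deleting
-- column 1 leaves an instance of the same process with N - 2 and k - 1 in place of N and k, since
-- A (2 + i) (2 + k) is 1, 1 followed by A (1 + i) (1 + k).  So if x and y are the first two entries
-- of Φ N μ, its remaining entries are those of Φ (N - 2) μ′, where μ′ collects the insertions that
-- pass column 1.
--
-- Say that column 1 has been used b times and that its counter is c just before the parts 1 are
-- inserted.  Then y = (N - 1) b - c and x = y + b + (the number of parts 1), which gives the
-- inequality between x and y; the one between y and the next entry holds because columns 1 and 2
-- are used alternately.  Conversely a reduced lecture hall partition determines μ′ by induction,
-- c as the residue of -y, and then μ, because a stage of the process is a bijection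
-- (m_k , c) ↦ (c′ , m′_k).
module Submission where

open import Defs
open import Data.Bool.Base using (if_then_else_; true; false; T)
open import Data.Integer.Base as ℤ using (ℤ; +_)
import Data.Integer.Properties as ℤ
open import Data.List.Base using (List; []; _∷_; _++_; length; filter; foldl; applyUpTo)
import Data.List.Base as List
open import Data.List.Properties
  using (foldl-++; filter-++; filter-none; filter-all; length-replicate; length-++)
open import Data.List.Relation.Unary.All as All using (All; []; _∷_)
import Data.List.Relation.Unary.All.Properties as All
open import Data.List.Relation.Unary.AllPairs using (AllPairs; []; _∷_)
import Data.List.Relation.Unary.AllPairs.Properties as AllPairs
open import Data.List.Relation.Unary.Linked using (Linked; []; [-]; _∷_)
import Data.List.Relation.Unary.Linked.Properties as Linked
open import Data.Nat.Base
open import Data.Nat.Divisibility using (_∣_; _∤_; ∣m+n∣m⇒∣n; ∣1⇒≡1; m∣m*n)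
open import Data.Nat.Properties
open import Data.Nat.Tactic.RingSolver using (solve-∀)
open import Data.Product.Base using (Σ; Σ-syntax; ∃-syntax; _×_; _,_; proj₁; proj₂)
open import Data.Rational.Unnormalised.Base as ℚᵘ using (*≤*)
open import Data.Unit.Base using (⊤; tt)
open import Data.Vec.Base using (Vec; []; _∷_; replicate)
open import Function.Base using (_∘_; _on_)
open import Function.Definitions using (Bijective)
open import Relation.Binary.PropositionalEquality
open import Relation.Nullary using (¬_; yes; no; contradiction)

private variable
  M n m i c c₁ c₂ b b₁ b₂ x x₁ x₂ y : ℕ
  ms ms₁ ms₂ ms′ ms″ : Vec ℕ n
  f g : ℕ → ℕ

-- Removing the first column

-- A vector lists multiplicities m_k , m_(k+1) , … , m_N, so that its head is inserted last.
Bounded : ∀ {n} → Vec ℕ n → Set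
Bounded         []       = ⊤
Bounded {suc n} (m ∷ ms) = m ≤ n × Bounded ms

-- Derive ms c b x ms′: once the multiplicities ms are inserted, column 1 has been used b times and
-- has counter c, and the columns after it have received ms′.  For ms = m_1 , m_2 , … the first
-- entry of the image is x.
-- In one stage m insertions either all decrement the counter of column 1 (stay), or the counter runs
-- to 0, is reset to n + 1, and is then decremented d more times, leaving c′ (wrap).
data Derive : ∀ {n} → Vec ℕ (suc n) → (c b x : ℕ) → Vec ℕ n → Set where
  single : Derive (0 ∷ []) 0 0 0 []
  stay   : ∀ {n} {ms : Vec ℕ (suc n)} {c b x ms′} m →
           Derive ms (m + c) b x ms′ →
           Derive (m ∷ ms) c b (x + b + m) (m ∷ ms′)
  wrap   : ∀ {n} {ms : Vec ℕ (suc n)} {c c′ b x ms′} m d →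
           Derive ms c b x ms′ → m ≡ c + d → m ≤ n → c′ + d ≡ suc n →
           Derive (suc m ∷ ms) c′ (suc b) (x + b + suc m) (m ∷ ms′)

position-≤ : Derive {n} ms c b x ms′ → c ≤ n
position-≤ single = z≤n
position-≤ (stay {c = c} m D) = ≤-trans (m≤n+m c m) (m≤n⇒m≤1+n (position-≤ D))
position-≤ (wrap {c′ = c′} m d D _ _ eq) = ≤-trans (m≤m+n c′ d) (≤-reflexive eq)

derive-bounded : Derive ms c b x ms′ → Bounded ms
derive-bounded single = z≤n , tt
derive-bounded (stay {c = c} m D) =
  ≤-trans (m≤m+n m c) (m≤n⇒m≤1+n (position-≤ D)) , derive-bounded D
derive-bounded (wrap m d D _ m≤n _) = s≤s m≤n , derive-bounded D

derived-bounded : Derive ms c b x ms′ → Bounded ms′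
derived-bounded single = tt
derived-bounded (stay {c = c} m D) = ≤-trans (m≤m+n m c) (position-≤ D) , derived-bounded D
derived-bounded (wrap m d D _ m≤n _) = m≤n , derived-bounded D

-- Passing column 1 moves one unit from `c` to `x`. Using it adds 1 to `x` and resets the counter
-- from 0 to one less than the new width, so the sum grows by that width. The `b` that each stage
-- adds to `x` accounts for the width growing by 1.
entry+position : Derive {n} ms c b x ms′ → x + c ≡ suc n * b
entry+position single = refl
entry+position {suc n} (stay {c = c} {b} {x} m D) = begin
  x + b + m + c      ≡⟨ shuffle x b m c ⟩
  b + (x + (m + c))  ≡⟨ cong (λ u → b + u) (entry+position D) ⟩
  b + suc n * b      ∎
  where
  open ≡-Reasoning
  shuffle : ∀ x b m c → x + b + m + c ≡ b + (x + (m + c))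
  shuffle = solve-∀
entry+position {suc n} (wrap {c = c} {c′} {b} {x} m d D refl _ eq) = begin
  x + b + suc (c + d) + c′          ≡⟨ shuffle x b c d c′ ⟩
  suc (b + (x + c) + (c′ + d))      ≡⟨ cong₂ (λ u v → suc (b + u + v)) (entry+position D) eq ⟩
  suc (b + suc n * b + suc n)       ≡⟨ collect n b ⟩
  suc (suc n) * suc b               ∎
  where
  open ≡-Reasoning
  shuffle : ∀ x b c d c′ → x + b + suc (c + d) + c′ ≡ suc (b + (x + c) + (c′ + d))
  shuffle = solve-∀
  collect : ∀ n b → suc (b + suc n * b + suc n) ≡ suc (suc n) * suc b
  collect = solve-∀

-- The stage stays if `m` is at most the counter. Otherwise `d = m - c - 1` passes follow the use of
-- column 1, and `m ≤ suc n` keeps them from exhausting the reset counter.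
derive-extend : ∀ {m} → Derive {n} ms c b x ms′ → m ≤ suc n →
                ∃[ c′ ] ∃[ b′ ] ∃[ ms″ ] Derive (m ∷ ms) c′ b′ (x + b + m) ms″
derive-extend {n} {c = c} {b} {m = m} D m≤ with m ≤? c
... | yes m≤c with c′ , refl ← m≤n⇒∃[o]m+o≡n m≤c = c′ , b , _ , stay m D
derive-extend {n} {c = c} {b} {m = m} D m≤ | no m≰c with m≤n⇒∃[o]m+o≡n (≰⇒> m≰c)
... | d , refl = suc n ∸ d , suc b , _ , wrap (c + d) d D refl (s≤s⁻¹ m≤)
                   (m∸n+n≡m (≤-trans (m≤n+m d c) (m≤n⇒m≤1+n (s≤s⁻¹ m≤))))

derive-total : ∀ (ms : Vec ℕ (suc n)) → Bounded ms →
               ∃[ c ] ∃[ b ] ∃[ x ] ∃[ ms′ ] Derive ms c b x ms′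
derive-total (zero ∷ []) _ = 0 , 0 , 0 , [] , single
derive-total (suc _ ∷ []) (() , _)
derive-total (m ∷ ms@(_ ∷ _)) (m≤ , bs)
  with _ , _ , _ , _ , D ← derive-total ms bs
  with _ , _ , _ , D′ ← derive-extend D m≤
  = _ , _ , _ , _ , D′

-- Tells the two kinds of stage apart by what they leave behind: after a stay `m + c ≤ n`, whereas a
-- wrap needs `m` to be at least `d = suc n - c`.
stay-wrap-exclusive : ∀ {m d} → m + c ≤ n → m ≡ c₁ + d → c + d ≢ suc n
stay-wrap-exclusive {c} {n} {c₁} {m} {d} m+c≤n eq eq′ = contradiction m+c≤n (<⇒≱ (begin-strict
  n             <⟨ n<1+n n ⟩
  suc n         ≡⟨ eq′ ⟨
  c + d         ≡⟨ +-comm c d ⟩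
  d + c         ≤⟨ +-monoˡ-≤ c (m≤n+m d c₁) ⟩
  c₁ + d + c    ≡⟨ cong (_+ c) eq ⟨
  m + c         ∎))
  where open ≤-Reasoning

-- A stage can be run backwards. The counter after it and the derived multiplicity fix the
-- constructor, then `d`, and then the counter before it.
derive-injective : Derive ms₁ c b₁ x₁ ms′ → Derive ms₂ c b₂ x₂ ms′ → ms₁ ≡ ms₂ × b₁ ≡ b₂
derive-injective single single = refl , refl
derive-injective (stay m D) (stay .m E) with refl , refl ← derive-injective D E = refl , refl
derive-injective (stay m D) (wrap .m d E eq _ eq′) =
  contradiction eq′ (stay-wrap-exclusive (position-≤ D) eq)
derive-injective (wrap m d D eq _ eq′) (stay .m E) =
  contradiction eq′ (stay-wrap-exclusive (position-≤ E) eq)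
derive-injective (wrap {c = c₁} {c} m d D eq _ eq′) (wrap {c = c₂} .m d₂ E eq₂ _ eq₂′)
  with refl ← +-cancelˡ-≡ c d d₂ (trans eq′ (sym eq₂′))
  with refl ← +-cancelʳ-≡ d c₁ c₂ (trans (sym eq) eq₂)
  with refl , refl ← derive-injective D E = refl , refl

derive-surjective : ∀ c (ms′ : Vec ℕ n) → c ≤ n → Bounded ms′ →
                    ∃[ ms ] ∃[ b ] ∃[ x ] Derive ms c b x ms′
derive-surjective .0 [] z≤n _ = 0 ∷ [] , 0 , 0 , single
derive-surjective {suc n} c (m ∷ ms′) c≤ (m≤n , bs) with m≤n⇒∃[o]m+o≡n c≤
-- A counter reset to `suc n` needs `d` passes to come down to `c`, so the stage wraps exactly when
-- the `m` derived insertions can contain them.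
... | d , eq with d ≤? m
...   | yes d≤m with m≤n⇒∃[o]m+o≡n d≤m
...     | c₀ , refl with derive-surjective c₀ ms′ (≤-trans (m≤n+m c₀ d) m≤n) bs
...       | _ , _ , _ , D = _ , _ , _ , wrap (d + c₀) d D (+-comm d c₀) m≤n eq
derive-surjective {suc n} c (m ∷ ms′) c≤ (m≤n , bs) | d , eq | no d≰m
  with derive-surjective (m + c) ms′
         (s≤s⁻¹ (≤-trans (+-monoˡ-≤ c (≰⇒> d≰m)) (≤-reflexive (trans (+-comm d c) eq)))) bs
... | _ , _ , _ , D = _ , _ , _ , stay m D

-- Alternation of columns 1 and 2

data Interlaced (c b c₂ b₂ : ℕ) : Set where
  even  : b ≡ b₂ → c ≤ c₂ → Interlaced c b c₂ b₂
  ahead : b ≡ suc b₂ → c₂ < c → Interlaced c b c₂ b₂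

-- In the queue of columns, `c` counts the later columns ahead of column 1, and `c₂` the columns
-- after column 2 that are ahead of column 2. Hence `c ≤ c₂` means that column 1 is due before
-- column 2. A used column moves to the end, so the two take turns.
interlaced : Derive {suc n} ms c b x ms′ → Derive ms′ c₂ b₂ x₂ ms″ → Interlaced c b c₂ b₂
interlaced (stay .0 single) single = even refl z≤n
interlaced (wrap .0 _ single refl _ eq) single = ahead refl (subst (0 <_) (sym (trans (sym (+-identityʳ _)) eq)) z<s)
interlaced (stay m D) (stay .m E) with interlaced D E
... | even b≡ c≤  = even b≡ (+-cancelˡ-≤ m _ _ c≤)
... | ahead b≡ c> = ahead b≡ (+-cancelˡ-< m _ _ c>)
-- Only column 2 is used in this stage, so column 1 was one use ahead before it and the counts agree
-- after it.
interlaced {suc n} (stay {c = c} .(suc m) D) (wrap {c = c₀} {c′} m d E eq _ eq′) with interlaced D E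
... | even _ c≤ = contradiction (begin-strict
        c₀            ≤⟨ m≤m+n c₀ d ⟩
        c₀ + d        ≡⟨ eq ⟨
        m             <⟨ n<1+n m ⟩
        suc m         ≤⟨ m≤m+n (suc m) c ⟩
        suc m + c     ∎) (≤⇒≯ c≤)
  where open ≤-Reasoning
... | ahead b≡ _ = even b≡ (+-cancelˡ-≤ d _ _ (begin
        d + c         ≤⟨ +-monoˡ-≤ c (≤-trans (m≤n+m d c₀) (≤-reflexive (sym eq))) ⟩
        m + c         ≤⟨ s≤s⁻¹ (position-≤ D) ⟩
        n             ≤⟨ n≤1+n n ⟩
        suc n         ≡⟨ eq′ ⟨
        c′ + d        ≡⟨ +-comm c′ d ⟩
        d + c′        ∎))
  where open ≤-Reasoning
-- Only column 1 is used in this stage, so the counts agreed before it and column 1 is one use ahead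
-- after it.
interlaced {suc n} (wrap {c = c₀} {c′} m d D eq _ eq′) (stay {c = c₂} .m E) with interlaced D E
... | even b≡ c≤  = ahead (cong suc b≡) (+-cancelʳ-< d _ _ (begin-strict
        c₂ + d        ≤⟨ +-monoʳ-≤ c₂ (≤-trans (m≤n+m d c₀) (≤-reflexive (sym eq))) ⟩
        c₂ + m        ≡⟨ +-comm c₂ m ⟩
        m + c₂        ≤⟨ position-≤ E ⟩
        n             <⟨ m<n⇒m<1+n (n<1+n n) ⟩
        suc (suc n)   ≡⟨ eq′ ⟨
        c′ + d        ∎))
  where open ≤-Reasoning
... | ahead _ c> = contradiction c> (≤⇒≯ (begin
        c₀            ≤⟨ m≤m+n c₀ d ⟩
        c₀ + d        ≡⟨ eq ⟨
        m             ≤⟨ m≤m+n m c₂ ⟩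
        m + c₂        ∎))
  where open ≤-Reasoning
interlaced {suc n} (wrap {c = c₁} {c} .(suc m) d D eq _ eq′) (wrap {c = c₀} {c₂} m e E eq₂ _ eq₂′) with interlaced D E
... | even b≡ c≤ = even (cong suc b≡) (+-cancelʳ-≤ d _ _ (begin
        c + d         ≡⟨ eq′ ⟩
        suc (suc n)   ≡⟨ cong suc eq₂′ ⟨
        suc (c₂ + e)  ≡⟨ +-suc c₂ e ⟨
        c₂ + suc e    ≤⟨ +-monoʳ-≤ c₂ (+-cancelˡ-≤ c₁ _ _ (begin
                           c₁ + suc e    ≡⟨ +-suc c₁ e ⟩
                           suc (c₁ + e)  ≤⟨ s≤s (+-monoˡ-≤ e c≤) ⟩
                           suc (c₀ + e)  ≡⟨ cong suc eq₂ ⟨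
                           suc m         ≡⟨ eq ⟩
                           c₁ + d        ∎)) ⟩
        c₂ + d        ∎))
  where open ≤-Reasoning
... | ahead b≡ c> = ahead (cong suc b≡) (+-cancelʳ-< e _ _ (begin-strict
        c₂ + e        ≡⟨ eq₂′ ⟩
        suc n         <⟨ n<1+n (suc n) ⟩
        suc (suc n)   ≡⟨ eq′ ⟨
        c + d         ≤⟨ +-monoʳ-≤ c (+-cancelˡ-≤ c₁ _ _ (begin
                           c₁ + d        ≡⟨ eq ⟨
                           suc m         ≡⟨ cong suc eq₂ ⟩
                           suc c₀ + e    ≤⟨ +-monoˡ-≤ e c> ⟩
                           c₁ + e        ∎)) ⟩
        c + e         ∎))
  where open ≤-Reasoning

-- Windows between consecutive entries

Lower Upper : ℕ → (ℕ → ℕ) → ℕ → Set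
Lower N f j = f (suc j) * width N j ≤ f j * width N (suc j)
Upper N f j = f j * width N (suc j) < (f (suc j) + width N (suc j)) * width N j

Vanishes : ℕ → (ℕ → ℕ) → Set
Vanishes N f = ∀ j → N ≤ j → f j ≡ 0

-- The form in which reduced lecture hall partitions are handled: `lower` is the ratio inequality
-- with denominators cleared, and `upper` says that subtracting `width N j` from entry `j` would
-- break it. Past the end the truncated width is 1, so `upper` at the last position forces that
-- entry to be 0.
record Windowed (N : ℕ) (f : ℕ → ℕ) : Set where
  constructor windowed
  field
    vanishes : Vanishes N f
    lower    : ∀ j → j < N → Lower N f j
    upper    : ∀ j → j < N → Upper N f j

open Windowed

prepend : ℕ → ℕ → (ℕ → ℕ) → ℕ → ℕ
prepend x y f 0             = x
prepend x y f 1             = y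
prepend x y f (suc (suc j)) = f j

-- In `step`, `m` counts the parts 1 and `ms` starts at the parts 3. A use of column 1 by the part
-- `2k - 1` adds `k` to the first entry and `k - 1` to the second. So the second entry is the `x` of
-- `ms` with all indices lowered by one, and the first exceeds it by `b + m`.
data Image : ∀ {N} → Vec ℕ N → (ℕ → ℕ) → Set where
  none : Image [] (λ _ → 0)
  one  : Image (0 ∷ []) (λ _ → 0)
  step : ∀ {n} {ms : Vec ℕ (suc n)} {c b x ms′ f} m →
         Derive ms c b x ms′ → m ≤ suc n → Image ms′ f →
         Image (m ∷ ms) (prepend (x + b + m) x f)

image-total : ∀ N (ms : Vec ℕ N) → Bounded ms → ∃[ f ] Image ms f
image-total 0 [] _ = _ , none
image-total 1 (zero ∷ []) _ = _ , one
image-total 1 (suc _ ∷ []) (() , _)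
image-total (suc (suc N)) (m ∷ ms) (m≤ , bs)
  with _ , _ , _ , ms′ , D ← derive-total ms bs
  with _ , I ← image-total N ms′ (derived-bounded D)
  = _ , step m D m≤ I

image-bounded : Image ms f → Bounded ms
image-bounded none = tt
image-bounded one = z≤n , tt
image-bounded (step m D m≤ I) = m≤ , derive-bounded D

image-head : ∀ {ms : Vec ℕ (suc n)} → Image ms f → ∃[ c ] ∃[ b ] ∃[ ms′ ] Derive ms c b (f 0) ms′
image-head one = _ , _ , _ , single
image-head (step m D m≤ I) with _ , _ , _ , D′ ← derive-extend D m≤ = _ , _ , _ , D′

-- Over the common denominator the first entry exceeds the second by `c + m * suc n`. As `c ≤ n`,
-- this makes `c` and `m` the remainder and quotient of the excess by `suc n`, and with `m ≤ suc n`
-- the excess fills exactly the window below `suc n * suc (suc n)`.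
top-scaled : Derive {n} ms c b x ms′ → ∀ m →
             (x + b + m) * suc n ≡ x * suc (suc n) + (c + m * suc n)
top-scaled {n} {c = c} {b} {x} D m = begin
  (x + b + m) * suc n                  ≡⟨ expand x b m n ⟩
  x * suc n + suc n * b + m * suc n    ≡⟨ cong (λ u → x * suc n + u + m * suc n) (entry+position D) ⟨
  x * suc n + (x + c) + m * suc n      ≡⟨ collect x c m n ⟩
  x * suc (suc n) + (c + m * suc n)    ∎
  where
  open ≡-Reasoning
  expand : ∀ x b m n → (x + b + m) * suc n ≡ x * suc n + suc n * b + m * suc n
  expand = solve-∀
  collect : ∀ x c m n → x * suc n + (x + c) + m * suc n ≡ x * suc (suc n) + (c + m * suc n)
  collect = solve-∀

-- The window between the first entries of two consecutive columns, with widths 2 + n and 1 + n.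
column-window : Derive {suc n} ms c b x ms′ → Derive ms′ c₂ b₂ x₂ ms″ →
                x₂ * suc (suc n) ≤ x * suc n × x * suc n < (x₂ + suc n) * suc (suc n)
column-window {n} {c = c} {b} {x} {c₂ = c₂} {b₂} {x₂} D E with interlaced D E
... | even refl c≤c₂ = lo , hi
  where
  open ≤-Reasoning
  -- The number of uses is eliminated: both sides are `b` times the product of the two widths.
  balance : x * suc n + c * suc n ≡ x₂ * suc (suc n) + c₂ * suc (suc n)
  balance = begin-equality
    x * suc n + c * suc n                     ≡⟨ *-distribʳ-+ (suc n) x c ⟨
    (x + c) * suc n                           ≡⟨ cong (_* suc n) (entry+position D) ⟩
    suc (suc n) * b * suc n                   ≡⟨ swap (suc (suc n)) b (suc n) ⟩
    suc n * b * suc (suc n)                   ≡⟨ cong (_* suc (suc n)) (entry+position E) ⟨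
    (x₂ + c₂) * suc (suc n)                   ≡⟨ *-distribʳ-+ (suc (suc n)) x₂ c₂ ⟩
    x₂ * suc (suc n) + c₂ * suc (suc n)       ∎
    where
    swap : ∀ r b s → r * b * s ≡ s * b * r
    swap = solve-∀
  lo : x₂ * suc (suc n) ≤ x * suc n
  lo = +-cancelʳ-≤ (c * suc n) _ _ (begin
    x₂ * suc (suc n) + c * suc n              ≤⟨ +-monoʳ-≤ (x₂ * suc (suc n)) (*-mono-≤ c≤c₂ (n≤1+n (suc n))) ⟩
    x₂ * suc (suc n) + c₂ * suc (suc n)       ≡⟨ balance ⟨
    x * suc n + c * suc n                     ∎)
  hi : x * suc n < (x₂ + suc n) * suc (suc n)
  hi = begin-strict
    x * suc n                                 ≤⟨ m≤m+n _ _ ⟩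
    x * suc n + c * suc n                     ≡⟨ balance ⟩
    x₂ * suc (suc n) + c₂ * suc (suc n)       ≡⟨ *-distribʳ-+ (suc (suc n)) x₂ c₂ ⟨
    (x₂ + c₂) * suc (suc n)                   <⟨ *-monoˡ-< (suc (suc n)) (+-monoʳ-< x₂ (s≤s (position-≤ E))) ⟩
    (x₂ + suc n) * suc (suc n)                ∎
... | ahead refl c₂<c = lo , hi
  where
  open ≤-Reasoning
  -- Column 1 has one use more than column 2, which contributes the product of the widths once more
  -- on the right.
  balance : x * suc n + c * suc n ≡ x₂ * suc (suc n) + (c₂ + suc n) * suc (suc n)
  balance = begin-equality
    x * suc n + c * suc n                               ≡⟨ *-distribʳ-+ (suc n) x c ⟨
    (x + c) * suc n                                     ≡⟨ cong (_* suc n) (entry+position D) ⟩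
    suc (suc n) * suc b₂ * suc n                        ≡⟨ swap (suc (suc n)) b₂ (suc n) ⟩
    (suc n * b₂ + suc n) * suc (suc n)                  ≡⟨ cong (λ u → (u + suc n) * suc (suc n)) (entry+position E) ⟨
    (x₂ + c₂ + suc n) * suc (suc n)                     ≡⟨ split x₂ c₂ (suc n) (suc (suc n)) ⟩
    x₂ * suc (suc n) + (c₂ + suc n) * suc (suc n)       ∎
    where
    swap : ∀ r b s → r * suc b * s ≡ (s * b + s) * r
    swap = solve-∀
    split : ∀ x c s r → (x + c + s) * r ≡ x * r + (c + s) * r
    split = solve-∀
  lo : x₂ * suc (suc n) ≤ x * suc n
  lo = +-cancelʳ-≤ (c * suc n) _ _ (begin
    x₂ * suc (suc n) + c * suc n                        ≤⟨ +-monoʳ-≤ (x₂ * suc (suc n)) (*-monoˡ-≤ (suc n) (≤-trans (position-≤ D)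
                                                             (≤-trans (n≤1+n (suc n)) (m≤n+m (suc (suc n)) c₂)))) ⟩
    x₂ * suc (suc n) + (c₂ + suc (suc n)) * suc n       ≤⟨ +-monoʳ-≤ (x₂ * suc (suc n)) (≤-trans (m≤m+n _ c₂) (≤-reflexive (regroup c₂ n))) ⟩
    x₂ * suc (suc n) + (c₂ + suc n) * suc (suc n)       ≡⟨ balance ⟨
    x * suc n + c * suc n                               ∎)
    where
    regroup : ∀ c n → (c + suc (suc n)) * suc n + c ≡ (c + suc n) * suc (suc n)
    regroup = solve-∀
  hi : x * suc n < (x₂ + suc n) * suc (suc n)
  hi = +-cancelʳ-< (c * suc n) _ _ (begin-strict
    x * suc n + c * suc n                               ≡⟨ balance ⟩
    x₂ * suc (suc n) + (c₂ + suc n) * suc (suc n)       ≡⟨ regroup x₂ c₂ n ⟩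
    (x₂ + suc n) * suc (suc n) + (c₂ + c₂ * suc n)      <⟨ +-monoʳ-< ((x₂ + suc n) * suc (suc n)) (+-monoˡ-< (c₂ * suc n) (s≤s (position-≤ E))) ⟩
    (x₂ + suc n) * suc (suc n) + suc c₂ * suc n         ≤⟨ +-monoʳ-≤ ((x₂ + suc n) * suc (suc n)) (*-monoˡ-≤ (suc n) c₂<c) ⟩
    (x₂ + suc n) * suc (suc n) + c * suc n              ∎)
    where
    regroup : ∀ x c n → x * suc (suc n) + (c + suc n) * suc (suc n) ≡ (x + suc n) * suc (suc n) + (c + c * suc n)
    regroup = solve-∀

image-windowed : ∀ {N} {ms : Vec ℕ N} → Image ms f → Windowed N f
image-windowed none = windowed (λ _ _ → refl) (λ _ ()) (λ _ ())
image-windowed one = windowed (λ _ _ → refl) (λ _ _ → z≤n) (λ { 0 _ → z<s ; (suc _) (s≤s ()) })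
image-windowed (step {n} {c = c} {b} {x} {f = f} m D m≤ I) = windowed van low upp
  where
  open ≤-Reasoning
  W = image-windowed I
  van : Vanishes (suc (suc n)) (prepend (x + b + m) x f)
  van (suc (suc j)) (s≤s (s≤s n≤j)) = vanishes W j n≤j
  -- `suc (n ∸ 1)` is the width at position 2. For `n = 0` there is no further column, the truncated
  -- width is 1, and both entries are 0.
  second : ∀ {n} {ms : Vec ℕ (suc n)} {c b x ms′} → Derive ms c b x ms′ → Image ms′ f →
           f 0 * suc n ≤ x * suc (n ∸ 1) × x * suc (n ∸ 1) < (f 0 + suc (n ∸ 1)) * suc n
  second single none = z≤n , z<s
  second {suc n} D I with _ , _ , _ , E ← image-head I = column-window D E
  low : ∀ j → j < suc (suc n) → Lower (suc (suc n)) (prepend (x + b + m) x f) j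
  low 0 _ = ≤-trans (m≤m+n _ _) (≤-reflexive (sym (top-scaled D m)))
  low 1 _ = proj₁ (second D I)
  low (suc (suc j)) (s≤s (s≤s j<n)) = lower W j j<n
  upp : ∀ j → j < suc (suc n) → Upper (suc (suc n)) (prepend (x + b + m) x f) j
  upp 0 _ = begin-strict
    (x + b + m) * suc n                        ≡⟨ top-scaled D m ⟩
    x * suc (suc n) + (c + m * suc n)          <⟨ +-monoʳ-< (x * suc (suc n)) (+-mono-<-≤ (s≤s (position-≤ D)) (*-monoˡ-≤ (suc n) m≤)) ⟩
    x * suc (suc n) + (suc n + suc n * suc n)  ≡⟨ collect x n ⟩
    (x + suc n) * suc (suc n)                  ∎
    where
    collect : ∀ x n → x * suc (suc n) + (suc n + suc n * suc n) ≡ (x + suc n) * suc (suc n)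
    collect = solve-∀
  upp 1 _ = proj₂ (second D I)
  upp (suc (suc j)) (s≤s (s≤s j<n)) = upper W j j<n

-- Recovering the multiplicities from a sequence

quotient-unique : ∀ {x} → x + c₁ ≡ suc n * b₁ → x + c₂ ≡ suc n * b₂ → c₁ ≤ n → c₂ ≤ n → b₁ ≤ b₂
quotient-unique {c₁} {n} {b₁} {c₂} {b₂} {x} eq₁ eq₂ c₁≤n c₂≤n = ≮⇒≥ λ b₂<b₁ → <-irrefl refl (begin-strict
  x + c₁             ≤⟨ +-mono-≤ (m≤m+n x c₂) c₁≤n ⟩
  x + c₂ + n         <⟨ +-monoʳ-< (x + c₂) (n<1+n n) ⟩
  x + c₂ + suc n     ≡⟨ cong (_+ suc n) eq₂ ⟩
  suc n * b₂ + suc n ≡⟨ trans (+-comm _ (suc n)) (sym (*-suc (suc n) b₂)) ⟩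
  suc n * suc b₂     ≤⟨ *-monoʳ-≤ (suc n) b₂<b₁ ⟩
  suc n * b₁         ≡⟨ eq₁ ⟨
  x + c₁             ∎)
  where open ≤-Reasoning

-- By `entry+position` and `position-≤`, the counter is the residue of `- x` modulo `suc n`.
position-unique : ∀ {ms₁ ms₂ : Vec ℕ (suc n)} →
                  Derive ms₁ c₁ b₁ x ms′ → Derive ms₂ c₂ b₂ x ms″ → c₁ ≡ c₂
position-unique {n} {c₁ = c₁} {b₁} {x} {c₂ = c₂} {b₂} D E =
  +-cancelˡ-≡ x c₁ c₂ (trans (entry+position D) (trans (cong (suc n *_) b₁≡b₂) (sym (entry+position E))))
  where
  b₁≡b₂ : b₁ ≡ b₂
  b₁≡b₂ = ≤-antisym
    (quotient-unique (entry+position D) (entry+position E) (position-≤ D) (position-≤ E))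
    (quotient-unique (entry+position E) (entry+position D) (position-≤ E) (position-≤ D))

-- The sequence is read from its end: the tail gives the derived multiplicities, the second entry
-- gives the counter, these two give all multiplicities but the first, and the first entry gives
-- that one.
image-injective : ∀ {N} {ms ns : Vec ℕ N} → Image ms f → Image ns g → f ≗ g → ms ≡ ns
image-injective none none _ = refl
image-injective one one _ = refl
image-injective (step {b = b} {x} m D _ I) (step m₁ E _ J) f≗g
  with refl ← f≗g 1
  with refl ← image-injective I J (λ j → f≗g (suc (suc j)))
  with refl ← position-unique D E
  with refl , refl ← derive-injective D E
  with refl ← +-cancelˡ-≡ (x + b) m m₁ (f≗g 0)
  = refl

-- Two entries with the same position are congruent modulo the width s, and a window leaves one
-- choice in each class.
window-unique : ∀ y₁ y₂ z s w → y₁ + c ≡ s * b₁ → y₂ + c ≡ s * b₂ →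
                z * s ≤ y₁ * w → y₂ * w < (z + w) * s → b₂ ≤ b₁
window-unique {c} {b₁} {b₂} y₁ y₂ z s w eq₁ eq₂ low high = ≮⇒≥ λ b₁<b₂ →
  <⇒≱ high (begin
    (z + w) * s        ≡⟨ distribute z w s ⟩
    z * s + s * w      ≤⟨ +-monoˡ-≤ (s * w) low ⟩
    y₁ * w + s * w     ≡⟨ *-distribʳ-+ w y₁ s ⟨
    (y₁ + s) * w       ≤⟨ *-monoˡ-≤ w (+-cancelʳ-≤ c _ _ (begin
                            y₁ + s + c     ≡⟨ rotate y₁ s c ⟩
                            s + (y₁ + c)   ≡⟨ cong (λ u → s + u) eq₁ ⟩
                            s + s * b₁     ≡⟨ *-suc s b₁ ⟨
                            s * suc b₁     ≤⟨ *-monoʳ-≤ s b₁<b₂ ⟩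
                            s * b₂         ≡⟨ eq₂ ⟨
                            y₂ + c         ∎)) ⟩
    y₂ * w             ∎)
  where
  open ≤-Reasoning
  distribute : ∀ z w s → (z + w) * s ≡ z * s + s * w
  distribute = solve-∀
  rotate : ∀ y s c → y + s + c ≡ s + (y + c)
  rotate = solve-∀

-- Division by `suc n` rounded up; `c` is the counter that an entry `y` must come with.
ceiling : ∀ n y → ∃[ c ] ∃[ b ] (c ≤ n × y + c ≡ suc n * b)
ceiling n zero = 0 , 0 , z≤n , sym (*-zeroʳ n)
ceiling n (suc y) with ceiling n y
... | zero  , b , _ , eq = n , suc b , ≤-refl ,
      trans (cong (λ u → suc (u + n)) (trans (sym (+-identityʳ y)) eq))
            (trans (+-comm (suc (suc n * b)) n) (trans (+-suc n _) (sym (*-suc (suc n) b))))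
... | suc c , b , c<n , eq = c , b , <⇒≤ c<n , trans (sym (+-suc y c)) eq

image-surjective : ∀ N f → Windowed N f → ∃[ ms ] ∃[ g ] (Image {N} ms g × f ≗ g)
image-surjective 0 f W = [] , _ , none , λ j → vanishes W j z≤n
image-surjective 1 f W = 0 ∷ [] , _ , one , λ
  { 0 → n<1⇒n≡0 (≤-trans (≤-reflexive (cong suc (sym (*-identityʳ (f 0)))))
                 (≤-trans (upper W 0 z<s)
                   (≤-reflexive (cong (λ u → (u + 1) * 1) (vanishes W 1 ≤-refl)))))
  ; (suc j) → vanishes W (suc j) (s≤s z≤n) }
image-surjective (suc (suc n)) f W = found
  where
  open ≤-Reasoning
  W′ : Windowed n (λ j → f (suc (suc j)))
  W′ = windowed (λ j le → vanishes W _ (s≤s (s≤s le)))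
                (λ j lt → lower W _ (s≤s (s≤s lt))) (λ j lt → upper W _ (s≤s (s≤s lt)))
  found : ∃[ ms ] ∃[ g ] (Image {suc (suc n)} ms g × f ≗ g)
  found
    with ms′ , g , I , f≗g ← image-surjective n (λ j → f (suc (suc j))) W′
    with c , b₀ , c≤n , y+c≡ ← ceiling n (f 1)
    with ms , b , y , D ← derive-surjective c ms′ c≤n (image-bounded I)
    = ones ∷ ms , _ , step ones D ones≤ I , λ { 0 → x≡ ; 1 → f1≡y ; (suc (suc j)) → f≗g j }
    where
    -- The tail and the counter fix `y` only modulo `suc n`. The window of `y` over `g 0` does not
    -- involve the number of parts 1, so 0 serves to obtain it.
    V : Windowed (suc (suc n)) (prepend (y + b + 0) y g)
    V = image-windowed (step 0 D z≤n I)
    -- `f 1` and `y` have the same residue and lie in the same window over `g 0`.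
    b₀≡b : b₀ ≡ b
    b₀≡b = ≤-antisym
      (window-unique y (f 1) (g 0) (suc n) (suc (n ∸ 1)) (entry+position D) y+c≡ (lower V 1 (s≤s (s≤s z≤n)))
        (subst (λ z → f 1 * suc (n ∸ 1) < (z + suc (n ∸ 1)) * suc n) (f≗g 0) (upper W 1 (s≤s (s≤s z≤n)))))
      (window-unique (f 1) y (g 0) (suc n) (suc (n ∸ 1)) y+c≡ (entry+position D)
        (subst (λ z → z * suc n ≤ f 1 * suc (n ∸ 1)) (f≗g 0) (lower W 1 (s≤s (s≤s z≤n))))
        (upper V 1 (s≤s (s≤s z≤n))))
    f1≡y : f 1 ≡ y
    f1≡y = +-cancelʳ-≡ c (f 1) y (trans y+c≡ (trans (cong (suc n *_) b₀≡b) (sym (entry+position D))))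
    base : (y + b) * suc n ≡ y * suc (suc n) + c
    base = trans (cong (_* suc n) (sym (+-identityʳ (y + b))))
             (trans (top-scaled D 0) (cong (λ u → y * suc (suc n) + u) (+-identityʳ c)))
    -- Since `c ≤ n`, the lower bound on `f 0` gives `y + b < suc (f 0)` after division by `suc n`.
    y+b≤x : y + b ≤ f 0
    y+b≤x = s≤s⁻¹ (*-cancelʳ-< (suc n) _ _ (begin-strict
      (y + b) * suc n                ≡⟨ base ⟩
      y * suc (suc n) + c            <⟨ +-mono-≤-< (subst (λ u → u * suc (suc n) ≤ f 0 * suc n) f1≡y (lower W 0 z<s)) (s≤s c≤n) ⟩
      f 0 * suc n + suc n            ≡⟨ +-comm _ (suc n) ⟩
      suc (f 0) * suc n              ∎))
    ones = f 0 ∸ (y + b)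
    x≡ : f 0 ≡ y + b + ones
    x≡ = sym (m+[n∸m]≡n y+b≤x)
    ones≤ : ones ≤ suc n
    ones≤ = s≤s⁻¹ (*-cancelʳ-< (suc n) _ _ (+-cancelˡ-< (y * suc (suc n)) _ _ (begin-strict
      y * suc (suc n) + ones * suc n           ≤⟨ +-monoʳ-≤ (y * suc (suc n)) (m≤n+m _ c) ⟩
      y * suc (suc n) + (c + ones * suc n)     ≡⟨ top-scaled D ones ⟨
      (y + b + ones) * suc n                   ≡⟨ cong (_* suc n) x≡ ⟨
      f 0 * suc n                           <⟨ upper W 0 z<s ⟩
      (f 1 + suc n) * suc (suc n)           ≡⟨ cong (λ u → (u + suc n) * suc (suc n)) f1≡y ⟩
      (y + suc n) * suc (suc n)             ≡⟨ distribute y n ⟩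
      y * suc (suc n) + suc (suc n) * suc n ∎)))
      where
      distribute : ∀ y n → (y + suc n) * suc (suc n) ≡ y * suc (suc n) + suc (suc n) * suc n
      distribute = solve-∀

-- Trapezoids and the insertion map

descend-2+ : ∀ n b → b ≤ suc n → descend (2 + n) b ≡ 2 + n ∷ 1 + n ∷ descend n b
descend-2+ n b b≤ = cong (applyUpTo (2 + n ∸_)) (+-∸-assoc 2 b≤)

-- trapezoid n k = trapezoid′ n (2 * k)
trapezoid′ : ℕ → ℕ → List ℕ
trapezoid′ n x = if x ≤ᵇ n then descend n ((n + 2) ∸ x) else descend n (x ∸ (n + 1))

-- Adding 2 to both arguments changes neither the comparison nor the lower end of either range, so
-- only the two largest entries are new. The hypothesis keeps the lower end of the second range at
-- most `suc n`, as `descend-2+` requires.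
trapezoid′-2+ : ∀ n x → suc x ≤ suc n + (n + 1) →
                trapezoid′ (2 + n) (2 + suc x) ≡ 2 + n ∷ 1 + n ∷ trapezoid′ n (suc x)
trapezoid′-2+ n x x< with suc x ≤ᵇ n
... | true  = descend-2+ n _ (≤-trans (∸-monoʳ-≤ {1} {suc x} (n + 2) (s≤s z≤n))
                                      (≤-reflexive (cong pred (+-comm n 2))))
... | false = descend-2+ n _ (m≤n+o⇒m∸n≤o (suc x) (n + 1) (≤-trans x< (≤-reflexive (+-comm (suc n) (n + 1)))))

trapezoid-2+ : ∀ n k → k ≤ n → trapezoid (2 + n) (2 + k) ≡ 2 + n ∷ 1 + n ∷ trapezoid n (1 + k)
trapezoid-2+ n k k≤n = trans (cong (trapezoid′ (2 + n)) (*-suc 2 (suc k)))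
  (trapezoid′-2+ n (k + suc (k + 0)) (begin
        2 * suc k               ≤⟨ *-monoʳ-≤ 2 (s≤s k≤n) ⟩
        2 * suc n               ≡⟨ double n ⟩
        suc n + (n + 1)         ∎))
  where
  open ≤-Reasoning
  double : ∀ n → 2 * suc n ≡ suc n + (n + 1)
  double = solve-∀

trapezoid-empty : ∀ k → trapezoid k (suc k) ≡ []
trapezoid-empty k with 2 * suc k ≤ᵇ k in eq
... | true  = contradiction (≤ᵇ⇒≤ (2 * suc k) k (subst T (sym eq) tt)) (<⇒≱ (m≤m+n (suc k) _))
... | false = cong (applyUpTo (k ∸_)) (m≤n⇒m∸n≡0 (≤-reflexive (sym (low k))))
  where
  low : ∀ k → 2 * suc k ∸ (k + 1) ≡ suc k
  low k = trans (cong (_∸ (k + 1)) (double k)) (m+n∸m≡n (k + 1) (suc k))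
    where
    double : ∀ n → 2 * suc n ≡ n + 1 + suc n
    double = solve-∀

A-suc : ∀ i k → A (suc i) (suc k) ≡ ⟦ trapezoid (suc (k + i)) (suc k) ⟧ ⊖ ⟦ trapezoid (k + i) (suc k) ⟧
A-suc i k rewrite +-suc k i = refl

A-first : ∀ k → A 1 (2 + k) ≡ ⟦ 2 + k ∷ 1 + k ∷ [] ⟧ ⊖ ⟦ [] ⟧
A-first k = trans (A-suc 0 (suc k)) (cong₂ (λ μ ν → ⟦ μ ⟧ ⊖ ⟦ ν ⟧)
  (begin
    trapezoid (2 + (k + 0)) (2 + k)   ≡⟨ cong (λ u → trapezoid (2 + u) (2 + k)) (+-identityʳ k) ⟩
    trapezoid (2 + k) (2 + k)         ≡⟨ trapezoid-2+ k k ≤-refl ⟩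
    2 + k ∷ 1 + k ∷ trapezoid k (1 + k) ≡⟨ cong (λ μ → 2 + k ∷ 1 + k ∷ μ) (trapezoid-empty k) ⟩
    2 + k ∷ 1 + k ∷ []                ∎)
  (trans (cong (λ u → trapezoid (1 + u) (2 + k)) (+-identityʳ k)) (trapezoid-empty (1 + k))))
  where open ≡-Reasoning

A-later : ∀ i k → A (2 + i) (2 + k) ≡
          ⟦ 3 + (k + i) ∷ 2 + (k + i) ∷ trapezoid (1 + (k + i)) (1 + k) ⟧ ⊖
          ⟦ 2 + (k + i) ∷ 1 + (k + i) ∷ trapezoid (k + i) (1 + k) ⟧
A-later i k = trans (A-suc (suc i) (suc k)) (cong₂ (λ μ ν → ⟦ μ ⟧ ⊖ ⟦ ν ⟧)
  (trans (cong (λ u → trapezoid (2 + u) (2 + k)) (+-suc k i))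
         (trapezoid-2+ (1 + (k + i)) k (m≤n⇒m≤1+n (m≤m+n k i))))
  (trans (cong (λ u → trapezoid (1 + u) (2 + k)) (+-suc k i))
         (trapezoid-2+ (k + i) k (m≤m+n k i))))

[1+n]-n : ∀ n → + suc n ℤ.- + n ≡ + 1
[1+n]-n n = trans (ℤ.m-n≡m⊖n (suc n) n) (trans (ℤ.⊖-≥ (n≤1+n n)) (cong +_ (m+n∸n≡m 1 n)))

A-first-0 : ∀ k → A 1 (2 + k) 0 ≡ + (2 + k)
A-first-0 k = trans (cong (λ s → s 0) (A-first k)) (ℤ.+-identityʳ _)

A-first-1 : ∀ k → A 1 (2 + k) 1 ≡ + (1 + k)
A-first-1 k = trans (cong (λ s → s 1) (A-first k)) (ℤ.+-identityʳ _)

A-first-2+ : ∀ k j → A 1 (2 + k) (2 + j) ≡ + 0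
A-first-2+ k j = cong (λ s → s (2 + j)) (A-first k)

A-later-0 : ∀ i k → A (2 + i) (2 + k) 0 ≡ + 1
A-later-0 i k = trans (cong (λ s → s 0) (A-later i k)) ([1+n]-n (2 + (k + i)))

A-later-1 : ∀ i k → A (2 + i) (2 + k) 1 ≡ + 1
A-later-1 i k = trans (cong (λ s → s 1) (A-later i k)) ([1+n]-n (1 + (k + i)))

A-later-2+ : ∀ i k j → A (2 + i) (2 + k) (2 + j) ≡ A (1 + i) (1 + k) j
A-later-2+ i k j = trans (cong (λ s → s (2 + j)) (A-later i k)) (cong (λ s → s j) (sym (A-suc i k)))

trapezoid-2+-1 : ∀ n → trapezoid (2 + n) 1 ≡ 2 + n ∷ []
trapezoid-2+-1 n rewrite +-comm n 2 | m+n∸n≡m 1 n = refl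

A-one-0 : ∀ i → A (suc i) 1 0 ≡ + 1
-- `trapezoid n 1` switches branches at `n = 2`, so the two columns that meet a smaller `n` are
-- computed separately.
A-one-0 0 = refl
A-one-0 1 = refl
A-one-0 (suc (suc i)) = trans (cong₂ (λ u v → (⟦ u ⟧ ⊖ ⟦ v ⟧) 0) (trapezoid-2+-1 (suc i)) (trapezoid-2+-1 i)) ([1+n]-n (2 + i))

A-one-suc : ∀ i j → A (suc i) 1 (suc j) ≡ + 0
A-one-suc 0 zero = refl
A-one-suc 0 (suc j) = refl
A-one-suc 1 zero = refl
A-one-suc 1 (suc j) = refl
A-one-suc (suc (suc i)) j = cong₂ (λ u v → (⟦ u ⟧ ⊖ ⟦ v ⟧) (suc j)) (trapezoid-2+-1 (suc i)) (trapezoid-2+-1 i)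

-- The insertion process without its first column

State : ℕ → Set
State M = Seq × Vec ℕ M

start : ∀ M → State M
start M = (λ _ → + 0) , replicate M 0

-- `n` stands for `N - k`, the only way in which `N` enters the new counter value.
insertPart : ∀ {M} → ℕ → ℕ → State M → State M
insertPart n k (s , I) = s ⊕ A (firstZero I) k , updateCounter (suc n ∸ firstZero I) I

repeat : ∀ {S : Set} → ℕ → (S → S) → S → S
repeat zero    f e = e
repeat (suc m) f e = repeat m f (f e)

repeat-+ : ∀ {S : Set} m n (f : S → S) e → repeat (m + n) f e ≡ repeat n f (repeat m f e)
repeat-+ zero    n f e = refl
repeat-+ (suc m) n f e = repeat-+ m n f (f e)

run : ∀ M k {n} → Vec ℕ n → State M
run M k []               = start M
run M k {suc n} (m ∷ ms) = repeat m (insertPart n k) (run M (suc k) ms)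

firstZero-suc : ∀ {M} (I : Vec ℕ M) → ∃[ i ] firstZero I ≡ suc i
firstZero-suc []          = 0 , refl
firstZero-suc (zero  ∷ I) = 0 , refl
firstZero-suc (suc _ ∷ I) = firstZero I , refl

record Splits {M} (st : State (suc M)) (c x y : ℕ) (st′ : State M) : Set where
  constructor splits
  field
    counter : proj₂ st ≡ c ∷ proj₂ st′
    first   : proj₁ st 0 ≡ + x
    second  : proj₁ st 1 ≡ + y
    rest    : ∀ j → proj₁ st (2 + j) ≡ proj₁ st′ j

private variable
  st : State (suc M)
  st′ : State M

splits-cast : ∀ {c′ x′ y′} → c ≡ c′ → x ≡ x′ → y ≡ y′ → Splits st c x y st′ → Splits st c′ x′ y′ st′
splits-cast refl refl refl S = S

-- Column 1 is the first zero and absorbs the insertion, which the smaller process does not see.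
splits-zero : ∀ n k → Splits st 0 x y st′ →
              Splits (insertPart n (2 + k) st) n (x + (2 + k)) (y + (1 + k)) st′
splits-zero {st = s , _ ∷ I} n k (splits refl f e r) = splits refl
  (cong₂ ℤ._+_ f (A-first-0 k)) (cong₂ ℤ._+_ e (A-first-1 k))
  (λ j → trans (cong₂ ℤ._+_ (r j) (A-first-2+ k j)) (ℤ.+-identityʳ _))

-- Column 1 is passed. The smaller process receives the part with its index lowered by one, and
-- stores the same counter value because `n` and the column number both drop by one.
splits-suc : ∀ n k → Splits st (suc c) x y st′ →
             Splits (insertPart (suc n) (2 + k) st) c (x + 1) (y + 1) (insertPart n (1 + k) st′)
splits-suc {st = s , _ ∷ I} {st′ = s′ , .I} n k (splits refl f e r) with firstZero I | firstZero-suc I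
... | _ | i , refl = splits refl
  (cong₂ ℤ._+_ f (A-later-0 i k)) (cong₂ ℤ._+_ e (A-later-1 i k))
  (λ j → cong₂ ℤ._+_ (r j) (A-later-2+ i k j))

splits-stay : ∀ m n k → Splits st (m + c) x y st′ →
              Splits (repeat m (insertPart (suc n) (2 + k)) st) c (x + m) (y + m)
                     (repeat m (insertPart n (1 + k)) st′)
splits-stay {c = c} {x} {y} zero n k S =
  splits-cast refl (sym (+-identityʳ x)) (sym (+-identityʳ y)) S
splits-stay {c = c} {x} {y} (suc m) n k S =
  splits-cast refl (+-assoc x 1 m) (+-assoc y 1 m)
    (splits-stay m n k (splits-suc n k S))

splits-wrap : ∀ {c′} d n k → Splits st c x y st′ → c′ + d ≡ suc n →
              Splits (repeat (suc (c + d)) (insertPart (suc n) (2 + k)) st) c′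
                     (x + c + (2 + k) + d) (y + c + (1 + k) + d)
                     (repeat (c + d) (insertPart n (1 + k)) st′)
splits-wrap {st = st} {c} {st′ = st′} {c′} d n k S eq =
  subst₂ (λ u v → Splits u c′ _ _ v)
    (sym (trans (cong (λ m → repeat m (insertPart (suc n) (2 + k)) st) (sym (+-suc c d)))
                (repeat-+ c (suc d) (insertPart (suc n) (2 + k)) st)))
    (sym (repeat-+ c d (insertPart n (1 + k)) st′))
    (splits-stay d n k
      (splits-cast (trans (sym eq) (+-comm c′ d)) refl refl
        (splits-zero (suc n) k
          (splits-stay c n k (splits-cast (sym (+-identityʳ c)) refl refl S)))))

-- `Derive` is normalised so that the index of its head is 1. Raising all indices by `suc k` adds
-- `suc k` to the first entry for each of the `b` uses of column 1, and one less to the second. The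
-- same shift, by one index, is the `b` that each stage of `Derive` adds to `x`.
derive-splits : ∀ {ms : Vec ℕ (suc n)} {b ms′} → Derive ms c b x ms′ → ∀ M k →
                Splits (run (suc M) (2 + k) ms) c (x + suc k * b) (x + k * b) (run M (1 + k) ms′)
derive-splits single M k rewrite *-zeroʳ k = splits refl refl refl (λ _ → refl)
derive-splits (stay {n} {c = c} {b} {x} m D) M k =
  splits-cast refl (shuffle x b m (suc k)) (shuffle x b m k)
    (splits-stay m n k (derive-splits D M (suc k)))
  where
  shuffle : ∀ x b m k → x + suc k * b + m ≡ x + b + m + k * b
  shuffle = solve-∀
derive-splits (wrap {n} {c = c} {c′} {b} {x} m d D refl _ eq) M k =
  splits-cast refl (shuffle x b c d (suc k)) (shuffle x b c d k)
    (splits-wrap d n k (derive-splits D M (suc k)) eq)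
  where
  shuffle : ∀ x b c d k → x + suc k * b + c + suc k + d ≡ x + b + suc (c + d) + k * suc b
  shuffle = solve-∀

-- A part 1 adds 1 to the first entry whichever column it uses, so the last stage needs no knowledge
-- of the counter.
repeat-one-0 : ∀ m n (st : State M) x → proj₁ st 0 ≡ + x →
               proj₁ (repeat m (insertPart n 1) st) 0 ≡ + (x + m)
repeat-one-0 zero n st x eq = trans eq (cong +_ (sym (+-identityʳ x)))
repeat-one-0 (suc m) n st@(s , I) x eq with i , eqᵢ ← firstZero-suc I =
  trans (repeat-one-0 m n (insertPart n 1 st) (x + 1)
          (cong₂ ℤ._+_ eq (trans (cong (λ u → A u 1 0) eqᵢ) (A-one-0 i))))
        (cong +_ (+-assoc x 1 m))

repeat-one-suc : ∀ m n (st : State M) j →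
                 proj₁ (repeat m (insertPart n 1) st) (suc j) ≡ proj₁ st (suc j)
repeat-one-suc zero n st j = refl
repeat-one-suc (suc m) n st@(s , I) j with i , eqᵢ ← firstZero-suc I =
  trans (repeat-one-suc m n (insertPart n 1 st) j)
        (trans (cong (ℤ._+_ (s (suc j))) (trans (cong (λ u → A u 1 (suc j)) eqᵢ) (A-one-suc i j)))
               (ℤ.+-identityʳ _))

-- Removing column 1 shortens the counter by 1 but lowers `N` by 2, so the induction needs the bound
-- `N ≤ suc M` in place of `M = N`.
image-run : ∀ {N} {ms : Vec ℕ N} {f} → Image ms f → ∀ M → N ≤ suc M → ∀ j → proj₁ (run M 1 ms) j ≡ + f j
image-run none M _ j = refl
image-run one M _ j = refl
image-run (step m D m≤ I) zero (s≤s ()) _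
image-run (step {n} {ms} {c} {b} {x} m D m≤ I) (suc M) (s≤s le) = entry
  where
  open Splits (derive-splits D M 0)
  st₂ = run (suc M) 2 ms
  entry : ∀ j → proj₁ (repeat m (insertPart (suc n) 1) st₂) j ≡ _
  entry 0 = repeat-one-0 m (suc n) st₂ (x + b) (trans first (cong (λ u → + (x + u)) (+-identityʳ b)))
  entry 1 = trans (repeat-one-suc m (suc n) st₂ 0) (trans second (cong +_ (+-identityʳ x)))
  entry (suc (suc j)) = trans (repeat-one-suc m (suc n) st₂ (suc j)) (trans (rest j) (image-run I M (<⇒≤ le) j))

-- Multiplicities as lists of parts in insertion order

expand : ℕ → ∀ {n} → Vec ℕ n → List ℕ
expand k []       = []
expand k (m ∷ ms) = expand (suc k) ms ++ List.replicate m (2 * k ∸ 1)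

foldl-replicate : ∀ {S : Set} (f : S → ℕ → S) e m p → foldl f e (List.replicate m p) ≡ repeat m (λ e → f e p) e
foldl-replicate f e zero    p = refl
foldl-replicate f e (suc m) p = foldl-replicate f (f e p) m p

repeat-cong : ∀ {S : Set} {f g : S → S} → f ≗ g → ∀ m → repeat m f ≗ repeat m g
repeat-cong f≗g zero    e = refl
repeat-cong {g = g} f≗g (suc m) e rewrite f≗g e = repeat-cong f≗g m (g e)

⌈odd/2⌉ : ∀ k → ⌈ 2 * suc k ∸ 1 /2⌉ ≡ suc k
⌈odd/2⌉ k rewrite +-identityʳ k = sym (n≡⌊n+n/2⌋ (suc k))

insert-odd : ∀ n k (st : State (k + suc n)) → insert (k + suc n) st (2 * suc k ∸ 1) ≡ insertPart n (suc k) st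
insert-odd n k (s , I) rewrite ⌈odd/2⌉ k = cong (λ u → s ⊕ A (firstZero I) (suc k) , updateCounter u I) (begin
  k + suc n + 1 ∸ (suc k + firstZero I)  ≡⟨ cong (_∸ (suc k + firstZero I)) (shuffle k n) ⟩
  suc k + suc n ∸ (suc k + firstZero I)  ≡⟨ [m+n]∸[m+o]≡n∸o (suc k) (suc n) (firstZero I) ⟩
  suc n ∸ firstZero I                    ∎)
  where
  open ≡-Reasoning
  shuffle : ∀ k n → k + suc n + 1 ≡ suc k + suc n
  shuffle = solve-∀

foldl-expand : ∀ N k (ms : Vec ℕ n) → k + n ≡ N →
               foldl (insert N) (start N) (expand (suc k) ms) ≡ run N (suc k) ms
foldl-expand N k [] _ = refl
foldl-expand {suc n} N k (m ∷ ms) refl = begin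
  foldl (insert N) (start N) (expand (2 + k) ms ++ List.replicate m p)
    ≡⟨ foldl-++ (insert N) (start N) (expand (2 + k) ms) _ ⟩
  foldl (insert N) (foldl (insert N) (start N) (expand (2 + k) ms)) (List.replicate m p)
    ≡⟨ foldl-replicate (insert N) _ m p ⟩
  repeat m (λ st → insert N st p) (foldl (insert N) (start N) (expand (2 + k) ms))
    ≡⟨ repeat-cong (insert-odd n k) m _ ⟩
  repeat m (insertPart n (suc k)) (foldl (insert N) (start N) (expand (2 + k) ms))
    ≡⟨ cong (repeat m (insertPart n (suc k))) (foldl-expand N (suc k) ms (sym (+-suc k n))) ⟩
  repeat m (insertPart n (suc k)) (run N (2 + k) ms) ∎
  where
  open ≡-Reasoning
  p = 2 * suc k ∸ 1

Φ-expand : ∀ {N} {ms : Vec ℕ N} {f} → Image ms f → ∀ j → Φ N (expand 1 ms) j ≡ + f j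
Φ-expand {N} {ms} I j =
  trans (cong (λ st → proj₁ st j) (foldl-expand N 0 ms refl)) (image-run I N (n≤1+n N) j)

-- Reduced lecture hall partitions as sequences

entry : List ℕ → ℕ → ℕ
entry []       j       = 0
entry (x ∷ μ)  zero    = x
entry (x ∷ μ)  (suc j) = entry μ j

⟦⟧-entry : ∀ μ j → ⟦ μ ⟧ j ≡ + entry μ j
⟦⟧-entry []      j       = refl
⟦⟧-entry (x ∷ μ) zero    = refl
⟦⟧-entry (x ∷ μ) (suc j) = ⟦⟧-entry μ j

entry-vanishes : ∀ μ → Vanishes (length μ) (entry μ)
entry-vanishes []      j       _        = refl
entry-vanishes (x ∷ μ) (suc j) (s≤s le) = entry-vanishes μ j le

LowerAll : ℕ → (ℕ → ℕ) → Set
LowerAll N f = ∀ j → Lower N f j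

lower-all : ∀ {N f} → Vanishes N f → (∀ j → j < N → Lower N f j) → LowerAll N f
lower-all {N} {f} van low j with j <? N
... | yes j<N = low j j<N
... | no  j≮N = subst (λ u → u * width N j ≤ f j * width N (suc j))
                  (sym (van (suc j) (m≤n⇒m≤1+n (≮⇒≥ j≮N)))) z≤n

ratio-lower : ∀ N μ j → ratio N μ j ℚᵘ.≥ ratio N μ (suc j) → Lower N (entry μ) j
ratio-lower N μ j (*≤* le) = ℤ.drop‿+≤+ (subst₂ ℤ._≤_ (num (suc j) j) (num j (suc j)) le)
  where
  num : ∀ i l → ⟦ μ ⟧ i ℤ.* + width N l ≡ + (entry μ i * width N l)
  num i l = trans (cong (ℤ._* + width N l) (⟦⟧-entry μ i)) (sym (ℤ.pos-* (entry μ i) (width N l)))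

lower-ratio : ∀ N μ j → Lower N (entry μ) j → ratio N μ j ℚᵘ.≥ ratio N μ (suc j)
lower-ratio N μ j le = *≤* (subst₂ ℤ._≤_ (sym (num (suc j) j)) (sym (num j (suc j))) (ℤ.+≤+ le))
  where
  num : ∀ i l → ⟦ μ ⟧ i ℤ.* + width N l ≡ + (entry μ i * width N l)
  num i l = trans (cong (ℤ._* + width N l) (⟦⟧-entry μ i)) (sym (ℤ.pos-* (entry μ i) (width N l)))

lectureHall-vanishes : ∀ {N μ} → LectureHall N μ → Vanishes N (entry μ)
lectureHall-vanishes {μ = μ} (_ , len , _) j N≤j = entry-vanishes μ j (≤-trans len N≤j)

lectureHall-lower : ∀ {N μ} → LectureHall N μ → LowerAll N (entry μ)
lectureHall-lower {N} {μ} (_ , _ , ratios) j with suc j <? length μ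
... | yes lt = ratio-lower N μ j (ratios j lt)
... | no  ge = subst (λ u → u * width N j ≤ entry μ j * width N (suc j))
                 (sym (entry-vanishes μ (suc j) (≮⇒≥ ge))) z≤n

-- Cutting at the first zero loses nothing under `LowerAll`, since then only zeros follow.
support : ℕ → (ℕ → ℕ) → List ℕ
support zero    f = []
support (suc N) f with f 0
... | zero  = []
... | suc x = suc x ∷ support N (f ∘ suc)

zero-tail : ∀ {N f} → LowerAll N f → f 0 ≡ 0 → ∀ j → f j ≡ 0
zero-tail low eq zero = eq
zero-tail {N} {f} low eq (suc j) = m*n≡0⇒m≡0 (f (suc j)) (width N j)
  (n≤0⇒n≡0 (≤-trans (low j) (≤-reflexive (cong (_* width N (suc j)) (zero-tail {N} {f} low eq j)))))

support-entry : ∀ N f → Vanishes N f → LowerAll N f → entry (support N f) ≗ f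
support-entry zero    f van low j = sym (van j z≤n)
support-entry (suc N) f van low j with f 0 in eq
... | zero  = sym (zero-tail {suc N} {f} low eq j)
support-entry (suc N) f van low zero    | suc x = sym eq
support-entry (suc N) f van low (suc j) | suc x =
  support-entry N (f ∘ suc) (λ i le → van (suc i) (s≤s le)) (λ i → low (suc i)) j

support-length : ∀ N f → length (support N f) ≤ N
support-length zero    f = z≤n
support-length (suc N) f with f 0
... | zero  = z≤n
... | suc _ = s≤s (support-length N (f ∘ suc))

support-positive : ∀ N f → All (1 ≤_) (support N f)
support-positive zero    f = []
support-positive (suc N) f with f 0
... | zero  = []
... | suc _ = s≤s z≤n ∷ support-positive N (f ∘ suc)

-- The widths weakly decrease, so the ratio inequalities already make the entries weakly decreasing.
lower-decreasing : ∀ {N f} → LowerAll N f → ∀ j → f (suc j) ≤ f j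
lower-decreasing {N} {f} low j = *-cancelʳ-≤ (f (suc j)) (f j) (width N j)
  (≤-trans (low j) (*-monoʳ-≤ (f j) (s≤s (∸-monoʳ-≤ N (n≤1+n (suc j))))))

entry-linked : ∀ μ → (∀ j → entry μ (suc j) ≤ entry μ j) → Linked _≥_ μ
entry-linked []          _   = []
entry-linked (x ∷ [])    _   = [-]
entry-linked (x ∷ y ∷ μ) dec = dec 0 ∷ entry-linked (y ∷ μ) (dec ∘ suc)

support-lectureHall : ∀ N f → Vanishes N f → LowerAll N f → LectureHall N (support N f)
support-lectureHall N f van low =
  (entry-linked μ (lower-decreasing {N} {entry μ} low′) , support-positive N f) ,
  support-length N f , λ j _ → lower-ratio N μ j (low′ j)
  where
  μ = support N f
  entries = support-entry N f van low
  low′ : LowerAll N (entry μ)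
  low′ j = subst₂ (λ u v → u * width N j ≤ v * width N (suc j))
             (sym (entries (suc j))) (sym (entries j)) (low j)

if-self : ∀ {A : Set} j {x y : A} → (if j ≡ᵇ j then x else y) ≡ x
if-self zero    = refl
if-self (suc j) = if-self j

if-other : ∀ {A : Set} {j i} {x y : A} → j ≢ i → (if j ≡ᵇ i then x else y) ≡ y
if-other {j = zero}  {zero}  neq = contradiction refl neq
if-other {j = zero}  {suc i} neq = refl
if-other {j = suc j} {zero}  neq = refl
if-other {j = suc j} {suc i} neq = if-other (neq ∘ cong suc)

lowerAtℕ : ℕ → ℕ → (ℕ → ℕ) → ℕ → ℕ
lowerAtℕ j d f i = if j ≡ᵇ i then f i ∸ d else f i

lowerAtℕ-≤ : ∀ j d f i → lowerAtℕ j d f i ≤ f i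
lowerAtℕ-≤ j d f i with j ≡ᵇ i
... | true  = m∸n≤m (f i) d
... | false = ≤-refl

lowerAt-lowerAtℕ : ∀ j d {s f} → (∀ i → s i ≡ + f i) → d ≤ f j → ∀ i → lowerAt j d s i ≡ + lowerAtℕ j d f i
lowerAt-lowerAtℕ j d {s} {f} eq d≤ i with j ≟ i
... | yes refl = begin
  lowerAt j d s j         ≡⟨ if-self j ⟩
  s j ℤ.- + d             ≡⟨ cong (ℤ._- + d) (eq j) ⟩
  + f j ℤ.- + d           ≡⟨ ℤ.m-n≡m⊖n (f j) d ⟩
  f j ℤ.⊖ d               ≡⟨ ℤ.⊖-≥ d≤ ⟩
  + (f j ∸ d)             ≡⟨ cong +_ (if-self j) ⟨
  + lowerAtℕ j d f j      ∎
  where open ≡-Reasoning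
... | no j≢i = trans (if-other j≢i) (trans (eq i) (cong +_ (sym (if-other j≢i))))

reduced-windowed : ∀ {N s} → (ReducedLectureHall N as-sequence) s →
                   ∃[ f ] (Windowed N f × (∀ j → s j ≡ + f j))
reduced-windowed {N} {s} (μ , (lh , irreducible) , s≗μ) =
  h , windowed van (λ j _ → low j) (λ j _ → upp j) , λ j → trans (s≗μ j) (⟦⟧-entry μ j)
  where
  h = entry μ
  van = lectureHall-vanishes lh
  low = lectureHall-lower lh
  upp : ∀ j → Upper N h j
  upp j with j <? length μ
  ... | no  j≮ rewrite entry-vanishes μ j (≮⇒≥ j≮) =
    *-mono-≤ {1} {h (suc j) + width N (suc j)} {1} {width N j}
      (≤-trans (s≤s z≤n) (m≤n+m (width N (suc j)) (h (suc j)))) (s≤s z≤n)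
  ... | yes j< = ≰⇒> λ reducible → irreducible j j< (below reducible)
    where
    w = width N j
    w′ = width N (suc j)
    h′ = lowerAtℕ j w h
    -- If the upper window fails at `j`, lowering entry `j` stays lecture hall: the inequality
    -- before `j` only becomes easier, and the one at `j` is the failed window with `w * w′` moved
    -- across.
    below : (h (suc j) + w′) * w ≤ h j * w′ → (LectureHall N as-sequence) (lowerAt j w ⟦ μ ⟧)
    below le = support N h′ , support-lectureHall N h′ van′ low′ , λ i → begin
        lowerAt j w ⟦ μ ⟧ i      ≡⟨ lowerAt-lowerAtℕ j w (⟦⟧-entry μ) w≤ i ⟩
        + h′ i                    ≡⟨ cong +_ (support-entry N h′ van′ low′ i) ⟨
        + entry (support N h′) i  ≡⟨ ⟦⟧-entry (support N h′) i ⟨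
        ⟦ support N h′ ⟧ i        ∎
      where
      open ≡-Reasoning
      w≤ : w ≤ h j
      w≤ = *-cancelʳ-≤ w (h j) w′ (≤-trans (≤-reflexive (*-comm w w′))
             (≤-trans (*-monoˡ-≤ w (m≤n+m w′ (h (suc j)))) le))
      van′ : Vanishes N h′
      van′ i N≤i = n≤0⇒n≡0 (≤-trans (lowerAtℕ-≤ j w h i) (≤-reflexive (van i N≤i)))
      low′ : LowerAll N h′
      low′ i with j ≟ i
      ... | no j≢i = ≤-trans (*-monoˡ-≤ (width N i) (lowerAtℕ-≤ j w h (suc i)))
              (≤-trans (low i) (≤-reflexive (cong (_* width N (suc i)) (sym (if-other j≢i)))))
      ... | yes refl = ≤-trans (*-monoˡ-≤ w (lowerAtℕ-≤ j w h (suc j)))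
              (≤-trans (m+n≤o⇒m≤o∸n (h (suc j) * w) (≤-trans (≤-reflexive sum) le))
                (≤-reflexive (trans (sym (*-distribʳ-∸ w′ (h j) w)) (cong (_* w′) (sym (if-self j))))))
        where
        sum : h (suc j) * w + w * w′ ≡ (h (suc j) + w′) * w
        sum = trans (cong (λ u → h (suc j) * w + u) (*-comm w w′)) (sym (*-distribʳ-+ w (h (suc j)) w′))

windowed-reduced : ∀ {N f s} → Windowed N f → (∀ j → s j ≡ + f j) → (ReducedLectureHall N as-sequence) s
windowed-reduced {N} {f} {s} W s≡ =
  μ , (support-lectureHall N f (vanishes W) low , λ j j< → irreducible j (≤-trans j< (support-length N f))) ,
  λ j → trans (s≡ j) (trans (cong +_ (sym (entries j))) (sym (⟦⟧-entry μ j)))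
  where
  μ = support N f
  low = lower-all {N} {f} (vanishes W) (lower W)
  entries = support-entry N f (vanishes W) low
  irreducible : ∀ j → j < N → ¬ (LectureHall N as-sequence) (lowerAt j (width N j) ⟦ μ ⟧)
  -- A lecture hall `ν` equal to the lowered sequence satisfies the ratio inequality at `j`; adding
  -- `w` back to its entry there contradicts `upper`.
  irreducible j j<N (ν , lh , eq) = <⇒≱ (upper W j j<N) (begin
    (f (suc j) + w′) * w              ≡⟨ *-distribʳ-+ w (f (suc j)) w′ ⟩
    f (suc j) * w + w′ * w            ≡⟨ cong (λ u → u * w + w′ * w) next ⟨
    entry ν (suc j) * w + w′ * w      ≤⟨ +-monoˡ-≤ (w′ * w) (lectureHall-lower lh j) ⟩
    entry ν j * w′ + w′ * w           ≡⟨ cong (λ u → entry ν j * w′ + u) (*-comm w′ w) ⟩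
    entry ν j * w′ + w * w′           ≡⟨ *-distribʳ-+ w′ (entry ν j) w ⟨
    (entry ν j + w) * w′              ≡⟨ cong (_* w′) here ⟩
    f j * w′                          ∎)
    where
    open ≤-Reasoning
    w = width N j
    w′ = width N (suc j)
    μ-entry : ∀ i → ⟦ μ ⟧ i ≡ + f i
    μ-entry i = trans (⟦⟧-entry μ i) (cong +_ (entries i))
    next : entry ν (suc j) ≡ f (suc j)
    next = ℤ.+-injective (trans (sym (⟦⟧-entry ν (suc j))) (trans (sym (eq (suc j)))
             (trans (if-other {j = j} (1+n≢n ∘ sym)) (μ-entry (suc j)))))
    lowered : + entry ν j ≡ + f j ℤ.- + w
    lowered = trans (sym (⟦⟧-entry ν j)) (trans (sym (eq j)) (trans (if-self j) (cong (ℤ._- + w) (μ-entry j))))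
    here : entry ν j + w ≡ f j
    here = ℤ.+-injective (trans (cong (ℤ._+ + w) lowered)
             (trans (ℤ.+-assoc (+ f j) (ℤ.- + w) (+ w))
               (trans (cong (ℤ._+_ (+ f j)) (ℤ.+-inverseˡ (+ w))) (ℤ.+-identityʳ (+ f j)))))

-- Reduced odd partitions as multiplicities

private variable
  μ ν : List ℕ

multiplicity-++ : ∀ i μ ν → multiplicity i (μ ++ ν) ≡ multiplicity i μ + multiplicity i ν
multiplicity-++ i μ ν = trans (cong length (filter-++ (i ≟_) μ ν)) (length-++ (filter (i ≟_) μ))

multiplicity-none : All (i ≢_) μ → multiplicity i μ ≡ 0
multiplicity-none {i} i≢ = cong length (filter-none (i ≟_) i≢)

multiplicity-replicate : ∀ m i → multiplicity i (List.replicate m i) ≡ m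
multiplicity-replicate m i = trans (cong length (filter-all (i ≟_) (All.replicate⁺ m refl))) (length-replicate m)

odd : ℕ → ℕ
odd k = 2 * suc k ∸ 1

odd-suc : ∀ k → odd (suc k) ≡ 2 + odd k
odd-suc k = cong pred (*-suc 2 (suc k))

odd-mono-≤ : ∀ {k l} → k ≤ l → odd k ≤ odd l
odd-mono-≤ k≤l = ∸-monoˡ-≤ 1 (*-monoʳ-≤ 2 (s≤s k≤l))

odd-injective : ∀ {k l} → odd k ≡ odd l → k ≡ l
odd-injective {k} {l} eq = suc-injective (*-cancelˡ-≡ (suc k) (suc l) 2 (cong suc eq))

2∤odd : ∀ k → 2 ∤ odd k
2∤odd k 2∣odd with () ← ∣1⇒≡1 (∣m+n∣m⇒∣n {2} {odd k} {1}
  (subst (2 ∣_) (sym (+-comm (odd k) 1)) (m∣m*n (suc k))) 2∣odd)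

odd-next : ∀ {k q} → 2 ∤ q → odd k < q → odd (suc k) ≤ q
odd-next {k} {q} 2∤q lt = ≤-trans (≤-reflexive (odd-suc k))
  (≤∧≢⇒< lt (λ eq → 2∤q (subst (2 ∣_) eq (m∣m*n (suc k)))))

expand-≥ : ∀ k (ms : Vec ℕ n) → All (odd k ≤_) (expand (suc k) ms)
expand-≥ k []       = []
expand-≥ k (m ∷ ms) = All.++⁺ (All.map (≤-trans (odd-mono-≤ (n≤1+n k))) (expand-≥ (suc k) ms))
                              (All.replicate⁺ m ≤-refl)

replicate-decreasing : ∀ m a → AllPairs _≥_ (List.replicate m a)
replicate-decreasing zero    a = []
replicate-decreasing (suc m) a = All.replicate⁺ m ≤-refl ∷ replicate-decreasing m a

expand-decreasing : ∀ k (ms : Vec ℕ n) → AllPairs _≥_ (expand (suc k) ms)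
expand-decreasing k []       = []
expand-decreasing k (m ∷ ms) = AllPairs.++⁺ (expand-decreasing (suc k) ms) (replicate-decreasing m (odd k))
  (All.map (λ q≥ → All.replicate⁺ m (≤-trans (odd-mono-≤ (n≤1+n k)) q≥)) (expand-≥ (suc k) ms))

expand-odd : ∀ {N} k (ms : Vec ℕ n) → k + n ≡ N → All (λ q → 2 ∤ q × q ≤ 2 * N) (expand (suc k) ms)
expand-odd k [] _ = []
expand-odd {suc n} k (m ∷ ms) refl = All.++⁺ (expand-odd (suc k) ms (sym (+-suc k n)))
  (All.replicate⁺ m (2∤odd k ,
    ≤-trans (n≤1+n (odd k)) (*-monoʳ-≤ 2 (≤-trans (s≤s (m≤m+n k n)) (≤-reflexive (sym (+-suc k n)))))))

expand-multiplicity : ∀ {N} k (ms : Vec ℕ n) → k + n ≡ N → Bounded ms →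
                      ∀ l → multiplicity (odd l) (expand (suc k) ms) ≤ N ∸ suc l
expand-multiplicity k [] _ _ l = z≤n
expand-multiplicity {suc n} k (m ∷ ms) refl (m≤n , bs) l
  rewrite multiplicity-++ (odd l) (expand (2 + k) ms) (List.replicate m (odd k)) with l ≟ k
... | yes refl
  rewrite multiplicity-none {odd k}
            (All.map (λ q≥ → <⇒≢ (≤-trans (≤-trans (n≤1+n _) (≤-reflexive (sym (odd-suc k)))) q≥))
                     (expand-≥ (suc k) ms))
        | multiplicity-replicate m (odd k)
        | +-suc k n
        | m+n∸m≡n k n
  = m≤n
... | no l≢k
  rewrite multiplicity-none {odd l} {List.replicate m (odd k)} (All.replicate⁺ m (l≢k ∘ odd-injective))
        | +-identityʳ (multiplicity (odd l) (expand (2 + k) ms))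
  = expand-multiplicity (suc k) ms (sym (+-suc k n)) bs l

expand-reduced : ∀ {N} (ms : Vec ℕ N) → Bounded ms → ReducedOddPartition N (expand 1 ms)
expand-reduced ms bs =
  ((Linked.AllPairs⇒Linked (expand-decreasing 0 ms) , expand-≥ 0 ms) , expand-odd 0 ms refl) ,
  λ { (suc l) _ _ → expand-multiplicity 0 ms refl bs l }

split-least : ∀ a μ → AllPairs _≥_ μ → All (a ≤_) μ →
              ∃[ ν ] ∃[ m ] (All (a <_) ν × μ ≡ ν ++ List.replicate m a)
split-least a [] _ _ = [] , 0 , [] , refl
split-least a (x ∷ μ) (x≥ ∷ dec) (a≤x ∷ a≤) with split-least a μ dec a≤ | a ≟ x
... | ν , m , a<ν , refl | no a≢x = x ∷ ν , m , ≤∧≢⇒< a≤x a≢x ∷ a<ν , refl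
... | [] , m , _ , refl | yes refl = [] , suc m , [] , refl
-- The part `y > a` would come after a part equal to `a` in a decreasing list.
... | y ∷ ν , m , a<y ∷ _ , refl | yes refl = contradiction (All.head x≥) (<⇒≱ a<y)

decreasing-++ˡ : ∀ μ → AllPairs _≥_ (μ ++ ν) → AllPairs _≥_ μ
decreasing-++ˡ []      _           = []
decreasing-++ˡ (x ∷ μ) (x≥ ∷ dec) = All.++⁻ˡ μ x≥ ∷ decreasing-++ˡ μ dec

-- The copies of the least possible part `odd k` are stripped from the end. The remaining parts are
-- odd and larger, hence at least `odd (suc k)`.
expand-surjective : ∀ {N} n k μ → k + n ≡ N → AllPairs _≥_ μ →
                    All (odd k ≤_) μ → All (λ q → 2 ∤ q × q ≤ 2 * N) μ →
                    (∀ l → l < N → multiplicity (odd l) μ ≤ N ∸ suc l) →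
                    ∃[ ms ] (Bounded {n} ms × μ ≡ expand (suc k) ms)
expand-surjective zero k [] _ _ _ _ _ = [] , tt , refl
-- Here `k = N`, so a part would be at least `2N + 1`.
expand-surjective zero k (q ∷ μ) refl _ (odd≤q ∷ _) ((2∤q , q≤) ∷ _) _ =
  contradiction (≤-trans odd≤q (≤-trans q≤ (≤-reflexive (cong (2 *_) (+-identityʳ k)))))
    (<⇒≱ (≤-reflexive (sym (cong pred (*-suc 2 k)))))
expand-surjective {N} (suc n) k μ refl dec odd≤ parts mult
  with ν , m , odd<ν , refl ← split-least (odd k) μ dec odd≤
  with ms , bs , refl ← expand-surjective n (suc k) ν (sym (+-suc k n)) (decreasing-++ˡ ν dec)
         (All.zipWith (λ ((2∤q , _) , lt) → odd-next 2∤q lt) (All.++⁻ˡ ν parts , odd<ν))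
         (All.++⁻ˡ ν parts)
         (λ l l< → ≤-trans (m≤m+n _ _) (≤-trans (≤-reflexive (sym (multiplicity-++ (odd l) ν _))) (mult l l<)))
  = m ∷ ms , (m≤n , bs) , refl
  where
  m≤n : m ≤ n
  m≤n = begin
    m                                                        ≡⟨ multiplicity-replicate m (odd k) ⟨
    multiplicity (odd k) (List.replicate m (odd k))          ≤⟨ m≤n+m _ _ ⟩
    multiplicity (odd k) ν + multiplicity (odd k) (List.replicate m (odd k)) ≡⟨ multiplicity-++ (odd k) ν _ ⟨
    multiplicity (odd k) (ν ++ List.replicate m (odd k))     ≤⟨ mult k (m<m+n k z<s) ⟩
    k + suc n ∸ suc k                                        ≡⟨ cong (_∸ suc k) (+-suc k n) ⟩
    suc k + n ∸ suc k                                        ≡⟨ m+n∸m≡n (suc k) n ⟩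
    n                                                        ∎
    where open ≤-Reasoning

reduced-expand : ∀ {N μ} → ReducedOddPartition N μ → ∃[ ms ] (Bounded {N} ms × μ ≡ expand 1 ms)
reduced-expand {N} {μ} (((linked , positive) , parts) , mult) =
  expand-surjective N 0 μ refl (Linked.Linked⇒AllPairs (λ x≥y y≥z → ≤-trans y≥z x≥y) linked) positive parts
    (λ l l<N → mult (suc l) (s≤s z≤n) l<N)

-- The bijection, by way of multiplicity vectors and windowed sequences

mainTheorem4 : (N : ℕ) → .{{NonZero N}} →
    Σ[ maps ∈ (∀ μ → ReducedOddPartition N μ → (ReducedLectureHall N as-sequence) (Φ N μ)) ]
    Bijective {A = Σ (List ℕ) (ReducedOddPartition N)}
    {B = Σ Seq (ReducedLectureHall N as-sequence)}
    (_≡_ on proj₁) (_≗_ on proj₁)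
    (λ (μ , reduced) → Φ N μ , maps μ reduced)
mainTheorem4 N = maps , (λ {μ} {ν} → injective {μ} {ν}) , surjective
  where
  maps : ∀ μ → ReducedOddPartition N μ → (ReducedLectureHall N as-sequence) (Φ N μ)
  maps μ r
    with ms , bs , refl ← reduced-expand r
    with f , I ← image-total N ms bs
    = windowed-reduced (image-windowed I) (Φ-expand I)
  injective : ∀ {μ ν : Σ (List ℕ) (ReducedOddPartition N)} →
              Φ N (proj₁ μ) ≗ Φ N (proj₁ ν) → proj₁ μ ≡ proj₁ ν
  injective {μ , r} {ν , r′} Φμ≗Φν
    with ms , bs , refl ← reduced-expand r
    with ns , bs′ , refl ← reduced-expand r′
    with f , I ← image-total N ms bs
    with g , J ← image-total N ns bs′
    = cong (expand 1) (image-injective I J λ j →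
        ℤ.+-injective (trans (sym (Φ-expand I j)) (trans (Φμ≗Φν j) (Φ-expand J j))))
  surjective : ∀ (s : Σ Seq (ReducedLectureHall N as-sequence)) →
               ∃[ μ ] (∀ {z} → proj₁ z ≡ proj₁ μ → Φ N (proj₁ z) ≗ proj₁ s)
  surjective (s , r)
    with f , W , s≡f ← reduced-windowed r
    with ms , g , I , f≗g ← image-surjective N f W
    = (expand 1 ms , expand-reduced ms (image-bounded I)) ,
      λ { refl j → trans (Φ-expand I j) (sym (trans (s≡f j) (cong +_ (f≗g j)))) }
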